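{- Let $\mathcal L=(\Sigma,X)$ be a language and $\Lambda$ a basic fuzzy theory in $\mathcal L$. Let $\mathscr F_\Lambda\dashv\mathscr U_\Lambda$ be the free-model adjunction with counit $\epsilon$, let $\mathsf T_\Lambda=\mathscr U_\Lambda\circ\mathscr F_\Lambda$ be the associated monad on $\mathbf{Fuz}_H$, and let $\mathscr K:\mathbf{Mod}(\Lambda)\to\mathbf{EM}(\mathsf T_\Lambda)$ be the comparison functor, sending a model $\mathcal A$ to the Eilenberg–Moore algebra $\mathscr U_\Lambda(\epsilon_{\mathcal A}):\mathsf T_\Lambda(\mathscr U_\Lambda\mathcal A)\to\mathscr U_\Lambda\mathcal A$ and acting as the identity on underlying arrows. Then $\mathscr K$ is an isomorphism of categories. In particular $\mathbf{Mod}(\Lambda)$ and the category $\mathbf{EM}(\mathsf T_\Lambda)$ of Eilenberg–Moore algebras of $\mathsf T_\Lambda$ are isomorphic.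
   Context: $H$ is a frame with bottom $\bot$. An $H$-fuzzy set is a pair $(A,\mu_A)$ of a set $A$ and a function $\mu_A:A\to H$; an arrow $f:(A,\mu_A)\to(B,\mu_B)$ is a function with $\mu_A(x)\le\mu_B(f(x))$; they form $\mathbf{Fuz}_H$. For $n\ge1$, $(A,\mu_A)^n=(A^n,\mu)$ with $\mu(a_1,\dots,a_n)=\bigwedge_i\mu_A(a_i)$. A signature $\Sigma=(O,\mathrm{ar},C)$ consists of a set $O$ of operation symbols with arity $\mathrm{ar}:O\to\{1,2,3,\dots\}$ and a set $C$ of constant symbols. A language is a pair $\mathcal L=(\Sigma,X)$ with $X$ a set of variables. $\mathrm{Terms}(\mathcal L)$ is the smallest set containing $X\sqcup C$ and containing $f(t_1,\dots,t_{\mathrm{ar}(f)})$ whenever $f\in O$ and all $t_i\in\mathrm{Terms}(\mathcal L)$. A formula is either an equation $s\equiv t$ ($s,t$ terms) or a membership proposition $\mathsf E_l(t)$ with $l\in H$ and $t$ a term. A sequent $\Gamma\vdash\psi$ is a pair of a (possibly infinite) set $\Gamma$ of formulas and a formula $\psi$. A fuzzy theory in $\mathcal L$ is a set of sequents. A theory is basic if for every sequent $\Gamma\vdash\phi$ in it, every formula of $\Gamma$ has the form $x\equiv y$ or $\mathsf E_l(x)$ with $x,y\in X$ variables ($\phi$ arbitrary). A $\Sigma$-algebra $\mathcal A=((A,\mu_A),\Sigma^{\mathcal A})$ is an $H$-fuzzy set $(A,\mu_A)$ together with, for each $f\in O$, an arrow $f^{\mathcal A}:(A,\mu_A)^{\mathrm{ar}(f)}\to(A,\mu_A)$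 of $\mathbf{Fuz}_H$ and, for each $c\in C$, an element $c^{\mathcal A}\in A$. A morphism of $\Sigma$-algebras is an arrow of $\mathbf{Fuz}_H$ between the carriers preserving all constants and commuting with all operations. An assignment is a function $\iota:X\to A$; evaluation: $x^{\mathcal A,\iota}=\iota(x)$, $c^{\mathcal A,\iota}=c^{\mathcal A}$, $f(t_1,\dots,t_n)^{\mathcal A,\iota}=f^{\mathcal A}(t_1^{\mathcal A,\iota},\dots,t_n^{\mathcal A,\iota})$. $\mathcal A\vDash_\iota s\equiv t$ iff $s^{\mathcal A,\iota}=t^{\mathcal A,\iota}$; $\mathcal A\vDash_\iota\mathsf E_l(t)$ iff $l\le\mu_A(t^{\mathcal A,\iota})$. $\mathcal A$ satisfies $\Gamma\vdash\psi$ if for every assignment $\iota$ with $\mathcal A\vDash_\iota\phi$ for all $\phi\in\Gamma$ one has $\mathcal A\vDash_\iota\psi$. $\mathcal A$ is a model of a theory $\Lambda$ if it satisfies every sequent of $\Lambda$. $\mathbf{Mod}(\Lambda)$ is the full subcategory of the category of $\Sigma$-algebras on the models of $\Lambda$, and $\mathscr U_\Lambda:\mathbf{Mod}(\Lambda)\to\mathbf{Fuz}_H$ is the forgetful functor to carriers; it has a left adjoint $\mathscr F_\Lambda$ (free model functor). -}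

module Defs where

open import Level using (Level; suc; _⊔_; Lift)
import Data.Fin.Base as Fin
open import Data.Nat.Base as ℕ using (ℕ; NonZero)
open import Data.Product.Base using (Σ; Σ-syntax; _,_; proj₁; proj₂)
open import Data.Vec.Functional using (Vector; foldr)
import Data.Vec.Functional.Relation.Binary.Equality.Setoid as VecSetoid
open import Function.Base using (_on_)
open import Function.Bundles using (Func)
import Function.Construct.Composition as Composition
import Function.Construct.Identity as Identity
open import Relation.Binary.Bundles using (Setoid)
open import Relation.Binary.Core using (Rel)
open import Relation.Binary.Lattice.Bundles using (BoundedLattice)
open import Relation.Binary.PropositionalEquality.Core as ≡ using (_≡_)
import Relation.Binary.PropositionalEquality.Properties as ≡
import Relation.Binary.Reasoning.Setoid as SetoidReasoning
open import Relation.Binary.Structures using (IsEquivalence)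
open import Relation.Unary using (Pred; _∈_)

record Category (o ℓ e : Level) : Set (suc (o ⊔ ℓ ⊔ e)) where
  infix  4 _≈_ _⇒_
  infixr 9 _∘_
  field
    Obj : Set o
    _⇒_ : Obj → Obj → Set ℓ
    _≈_ : ∀ {A B} → Rel (A ⇒ B) e
    id  : ∀ {A} → A ⇒ A
    _∘_ : ∀ {A B C} → B ⇒ C → A ⇒ B → A ⇒ C

    assoc     : ∀ {A B C D} {f : A ⇒ B} {g : B ⇒ C} {h : C ⇒ D} →
                (h ∘ g) ∘ f ≈ h ∘ (g ∘ f)
    identityˡ : ∀ {A B} {f : A ⇒ B} → id ∘ f ≈ f
    identityʳ : ∀ {A B} {f : A ⇒ B} → f ∘ id ≈ f
    equiv     : ∀ {A B} → IsEquivalence (_≈_ {A} {B})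
    ∘-resp-≈  : ∀ {A B C} {f h : B ⇒ C} {g i : A ⇒ B} →
                f ≈ h → g ≈ i → f ∘ g ≈ h ∘ i

  module Equiv {A B : Obj} = IsEquivalence (equiv {A} {B})

  hom-setoid : (A B : Obj) → Setoid ℓ e
  hom-setoid A B = record { isEquivalence = equiv {A} {B} }

  module HomReasoning {A B : Obj} = SetoidReasoning (hom-setoid A B)

record Functor {o ℓ e o′ ℓ′ e′}
               (C : Category o ℓ e) (D : Category o′ ℓ′ e′) :
               Set (o ⊔ ℓ ⊔ e ⊔ o′ ⊔ ℓ′ ⊔ e′) where
  private
    module C = Category C
    module D = Category D
  field
    F₀ : C.Obj → D.Obj
    F₁ : ∀ {A B} → A C.⇒ B → F₀ A D.⇒ F₀ B

    identity     : ∀ {A} → F₁ (C.id {A}) D.≈ D.id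
    homomorphism : ∀ {X Y Z} {f : X C.⇒ Y} {g : Y C.⇒ Z} →
                   F₁ (g C.∘ f) D.≈ F₁ g D.∘ F₁ f
    F-resp-≈     : ∀ {A B} {f g : A C.⇒ B} → f C.≈ g → F₁ f D.≈ F₁ g

idF : ∀ {o ℓ e} {C : Category o ℓ e} → Functor C C
idF {C = C} = record
  { F₀           = λ A → A
  ; F₁           = λ f → f
  ; identity     = Equiv.refl
  ; homomorphism = Equiv.refl
  ; F-resp-≈     = λ p → p
  }
  where open Category C

infixr 9 _∘F_

_∘F_ : ∀ {o ℓ e o′ ℓ′ e′ o″ ℓ″ e″}
       {C : Category o ℓ e} {D : Category o′ ℓ′ e′} {E : Category o″ ℓ″ e″} →
       Functor D E → Functor C D → Functor C E
_∘F_ {E = E} G F = record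
  { F₀           = λ A → G.F₀ (F.F₀ A)
  ; F₁           = λ f → G.F₁ (F.F₁ f)
  ; identity     = Equiv.trans (G.F-resp-≈ F.identity) G.identity
  ; homomorphism = Equiv.trans (G.F-resp-≈ F.homomorphism) G.homomorphism
  ; F-resp-≈     = λ p → G.F-resp-≈ (F.F-resp-≈ p)
  }
  where
  module F = Functor F
  module G = Functor G
  open Category E

record NaturalTransformation {o ℓ e o′ ℓ′ e′}
                             {C : Category o ℓ e} {D : Category o′ ℓ′ e′}
                             (F G : Functor C D) :
                             Set (o ⊔ ℓ ⊔ e ⊔ o′ ⊔ ℓ′ ⊔ e′) where
  private
    module C = Category C
    module D = Category D
    module F = Functor F
    module G = Functor G
  field
    η       : ∀ X → F.F₀ X D.⇒ G.F₀ X
    commute : ∀ {X Y} (f : X C.⇒ Y) → η Y D.∘ F.F₁ f D.≈ G.F₁ f D.∘ η X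

infix 5 _⊣_

record _⊣_ {o ℓ e o′ ℓ′ e′}
           {C : Category o ℓ e} {D : Category o′ ℓ′ e′}
           (L : Functor C D) (R : Functor D C) :
           Set (o ⊔ ℓ ⊔ e ⊔ o′ ⊔ ℓ′ ⊔ e′) where
  private
    module C = Category C
    module D = Category D
    module L = Functor L
    module R = Functor R
  field
    unit   : NaturalTransformation idF (R ∘F L)
    counit : NaturalTransformation (L ∘F R) idF

  module unit   = NaturalTransformation unit
  module counit = NaturalTransformation counit

  field
    zig : ∀ {A} → counit.η (L.F₀ A) D.∘ L.F₁ (unit.η A) D.≈ D.id
    zag : ∀ {B} → R.F₁ (counit.η B) C.∘ unit.η (R.F₀ B) C.≈ C.id

record Monad {o ℓ e} (C : Category o ℓ e) : Set (o ⊔ ℓ ⊔ e) where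
  open Category C
  field
    T : Functor C C
    η : NaturalTransformation idF T
    μ : NaturalTransformation (T ∘F T) T

  module T = Functor T
  module η = NaturalTransformation η
  module μ = NaturalTransformation μ

  field
    μ-assoc     : ∀ {A} → μ.η A ∘ T.F₁ (μ.η A) ≈ μ.η A ∘ μ.η (T.F₀ A)
    μ-identityˡ : ∀ {A} → μ.η A ∘ T.F₁ (η.η A) ≈ id
    μ-identityʳ : ∀ {A} → μ.η A ∘ η.η (T.F₀ A) ≈ id

module _ {o ℓ e} {C : Category o ℓ e} (M : Monad C) where
  open Category C
  private module M = Monad M

  record EMAlgebra : Set (o ⊔ ℓ ⊔ e) where
    field
      A         : Obj
      action    : M.T.F₀ A ⇒ A
      act-unit  : action ∘ M.η.η A ≈ id
      act-assoc : action ∘ M.T.F₁ action ≈ action ∘ M.μ.η A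

  IsEMMorphism : (X Y : EMAlgebra) → EMAlgebra.A X ⇒ EMAlgebra.A Y → Set e
  IsEMMorphism X Y f =
    f ∘ EMAlgebra.action X ≈ EMAlgebra.action Y ∘ M.T.F₁ f

  record EMMorphism (X Y : EMAlgebra) : Set (ℓ ⊔ e) where
    field
      arr      : EMAlgebra.A X ⇒ EMAlgebra.A Y
      commutes : IsEMMorphism X Y arr

  private
    EM-id : ∀ X → IsEMMorphism X X id
    EM-id X = begin
      id ∘ action             ≈⟨ identityˡ ⟩
      action                  ≈⟨ identityʳ ⟨
      action ∘ id             ≈⟨ ∘-resp-≈ Equiv.refl M.T.identity ⟨
      action ∘ M.T.F₁ id      ∎
      where
      open EMAlgebra X
      open HomReasoning

    EM-∘ : ∀ X Y Z {f g} → IsEMMorphism Y Z g → IsEMMorphism X Y f →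
           IsEMMorphism X Z (g ∘ f)
    EM-∘ X Y Z {f} {g} p q = begin
      (g ∘ f) ∘ X.action                ≈⟨ assoc ⟩
      g ∘ (f ∘ X.action)                ≈⟨ ∘-resp-≈ Equiv.refl q ⟩
      g ∘ (Y.action ∘ M.T.F₁ f)         ≈⟨ assoc ⟨
      (g ∘ Y.action) ∘ M.T.F₁ f         ≈⟨ ∘-resp-≈ p Equiv.refl ⟩
      (Z.action ∘ M.T.F₁ g) ∘ M.T.F₁ f  ≈⟨ assoc ⟩
      Z.action ∘ (M.T.F₁ g ∘ M.T.F₁ f)  ≈⟨ ∘-resp-≈ Equiv.refl M.T.homomorphism ⟨
      Z.action ∘ M.T.F₁ (g ∘ f)         ∎
      where
      module X = EMAlgebra X
      module Y = EMAlgebra Y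
      module Z = EMAlgebra Z
      open HomReasoning

  EM : Category (o ⊔ ℓ ⊔ e) (ℓ ⊔ e) e
  EM = record
    { Obj       = EMAlgebra
    ; _⇒_       = EMMorphism
    ; _≈_       = λ f g → EMMorphism.arr f ≈ EMMorphism.arr g
    ; id        = λ {X} → record { arr = id ; commutes = EM-id X }
    ; _∘_       = λ {X} {Y} {Z} g f → record
      { arr      = EMMorphism.arr g ∘ EMMorphism.arr f
      ; commutes = EM-∘ X Y Z (EMMorphism.commutes g) (EMMorphism.commutes f)
      }
    ; assoc     = assoc
    ; identityˡ = identityˡ
    ; identityʳ = identityʳ
    ; equiv     = record
      { refl = Equiv.refl ; sym = Equiv.sym ; trans = Equiv.trans }
    ; ∘-resp-≈  = ∘-resp-≈
    }

module _ {o ℓ e o′ ℓ′ e′}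
         {C : Category o ℓ e} {D : Category o′ ℓ′ e′}
         {L : Functor C D} {R : Functor D C} (adj : L ⊣ R) where
  private
    module C = Category C
    module D = Category D
    module L = Functor L
    module R = Functor R
    open _⊣_ adj

    R-square : ∀ {X Y Y′ Z} {f : Y D.⇒ Z} {g : X D.⇒ Y}
               {h : Y′ D.⇒ Z} {k : X D.⇒ Y′} →
               f D.∘ g D.≈ h D.∘ k →
               R.F₁ f C.∘ R.F₁ g C.≈ R.F₁ h C.∘ R.F₁ k
    R-square p = C.Equiv.trans (C.Equiv.sym R.homomorphism)
                   (C.Equiv.trans (R.F-resp-≈ p) R.homomorphism)

  adjunctionMonad : Monad C
  adjunctionMonad = record
    { T           = R ∘F L
    ; η           = unit
    ; μ           = record
      { η       = λ A → R.F₁ (counit.η (L.F₀ A))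
      ; commute = λ f → R-square (counit.commute (L.F₁ f))
      }
    ; μ-assoc     = λ {A} → R-square (counit.commute (counit.η (L.F₀ A)))
    ; μ-identityˡ = C.Equiv.trans (C.Equiv.sym R.homomorphism)
                      (C.Equiv.trans (R.F-resp-≈ zig) R.identity)
    ; μ-identityʳ = zag
    }

  comparison : Functor D (EM adjunctionMonad)
  comparison = record
    { F₀           = λ B → record
      { A         = R.F₀ B
      ; action    = R.F₁ (counit.η B)
      ; act-unit  = zag
      ; act-assoc = R-square (counit.commute (counit.η B))
      }
    ; F₁           = λ f → record
      { arr      = R.F₁ f
      ; commutes = C.Equiv.sym (R-square (counit.commute f))
      }
    ; identity     = R.identity
    ; homomorphism = R.homomorphism
    ; F-resp-≈     = R.F-resp-≈
    }

-- Structures on setoids are only ever equal up to the setoid equality of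
-- their operations, so `_≡_` is too fine a notion of equality of objects.
-- A category carries instead an equivalence relation on objects; arrows
-- between equal objects are compared by means of the "identity" arrows
-- `coerce p`, which do not depend on the proof p.

record ObjectEquality {o ℓ e} (C : Category o ℓ e) (q : Level) :
                      Set (o ⊔ ℓ ⊔ e ⊔ suc q) where
  open Category C
  infix 4 _≈ₒ_
  field
    _≈ₒ_            : Rel Obj q
    isEquivalenceₒ  : IsEquivalence _≈ₒ_
    coerce          : ∀ {A B} → A ≈ₒ B → A ⇒ B
    coerce-id       : ∀ {A} (p : A ≈ₒ A) → coerce p ≈ id
    coerce-∘        : ∀ {A B C} (p : A ≈ₒ B) (q : B ≈ₒ C) (r : A ≈ₒ C) →
                      coerce q ∘ coerce p ≈ coerce r

  module Equivₒ = IsEquivalence isEquivalenceₒ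

module _ {o ℓ e o′ ℓ′ e′}
         {C : Category o ℓ e} {D : Category o′ ℓ′ e′} where

  record EqualFunctors {q′} (ED : ObjectEquality D q′) (F G : Functor C D) :
                       Set (o ⊔ ℓ ⊔ e′ ⊔ q′) where
    open Category D
    open ObjectEquality ED
    private
      module C = Category C
      module F = Functor F
      module G = Functor G
    field
      eq₀ : ∀ A → F.F₀ A ≈ₒ G.F₀ A
      eq₁ : ∀ {A B} (f : A C.⇒ B) →
            coerce (eq₀ B) ∘ F.F₁ f ≈ G.F₁ f ∘ coerce (eq₀ A)

  record PreservesObjectEquality {q q′} (EC : ObjectEquality C q)
                                 (ED : ObjectEquality D q′)
                                 (F : Functor C D) :
                                 Set (o ⊔ q ⊔ e′ ⊔ q′) where
    private
      module EC = ObjectEquality EC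
      module ED = ObjectEquality ED
      module F = Functor F
    open Category D
    field
      cong        : ∀ {A B} → A EC.≈ₒ B → F.F₀ A ED.≈ₒ F.F₀ B
      cong-coerce : ∀ {A B} (p : A EC.≈ₒ B) →
                    F.F₁ (EC.coerce p) ≈ ED.coerce (cong p)

module _ {o ℓ e q o′ ℓ′ e′ q′}
         {C : Category o ℓ e} {D : Category o′ ℓ′ e′}
         (EC : ObjectEquality C q) (ED : ObjectEquality D q′) where

  record IsIsomorphism (K : Functor C D) :
                       Set (o ⊔ ℓ ⊔ e ⊔ q ⊔ o′ ⊔ ℓ′ ⊔ e′ ⊔ q′) where
    field
      K-preserves   : PreservesObjectEquality EC ED K
      K⁻¹           : Functor D C
      K⁻¹-preserves : PreservesObjectEquality ED EC K⁻¹
      inverseˡ      : EqualFunctors ED (K ∘F K⁻¹) idF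
      inverseʳ      : EqualFunctors EC (K⁻¹ ∘F K) idF

  Isomorphic : Set (o ⊔ ℓ ⊔ e ⊔ q ⊔ o′ ⊔ ℓ′ ⊔ e′ ⊔ q′)
  Isomorphic = Σ[ K ∈ Functor C D ] IsIsomorphism K

-- For p = refl, `IsEMMorphism M X Y (coerce p)` says that the two actions
-- agree.

module _ {o ℓ e q} {C : Category o ℓ e}
         (E : ObjectEquality C q) (M : Monad C) where
  open Category C
  open ObjectEquality E
  private
    module M = Monad M
    module EMC = Category (EM M)

    coerceHom : ∀ {X Y} →
      Σ[ p ∈ EMAlgebra.A X ≈ₒ EMAlgebra.A Y ] IsEMMorphism M X Y (coerce p) →
      EMMorphism M X Y
    coerceHom (p , h) = record { arr = coerce p ; commutes = h }

    inverse : ∀ {A B} (p : A ≈ₒ B) → coerce (Equivₒ.sym p) ∘ coerce p ≈ id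
    inverse p = Equiv.trans (coerce-∘ p (Equivₒ.sym p) Equivₒ.refl)
                            (coerce-id Equivₒ.refl)

    inverse′ : ∀ {A B} (p : A ≈ₒ B) → coerce p ∘ coerce (Equivₒ.sym p) ≈ id
    inverse′ p = Equiv.trans (coerce-∘ (Equivₒ.sym p) p Equivₒ.refl)
                             (coerce-id Equivₒ.refl)

    transport : ∀ {X Y f g} → f ≈ g → IsEMMorphism M X Y f → IsEMMorphism M X Y g
    transport p h =
      Equiv.trans (∘-resp-≈ (Equiv.sym p) Equiv.refl)
        (Equiv.trans h (∘-resp-≈ Equiv.refl (M.T.F-resp-≈ p)))

    symHom : ∀ {X Y f g} → g ∘ f ≈ id → f ∘ g ≈ id →
             IsEMMorphism M X Y f → IsEMMorphism M Y X g
    symHom {X} {Y} {f} {g} gf fg h = begin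
      g ∘ y                              ≈⟨ identityʳ ⟨
      (g ∘ y) ∘ id                       ≈⟨ ∘-resp-≈ Equiv.refl M.T.identity ⟨
      (g ∘ y) ∘ M.T.F₁ id                ≈⟨ ∘-resp-≈ Equiv.refl (M.T.F-resp-≈ fg) ⟨
      (g ∘ y) ∘ M.T.F₁ (f ∘ g)           ≈⟨ ∘-resp-≈ Equiv.refl M.T.homomorphism ⟩
      (g ∘ y) ∘ (M.T.F₁ f ∘ M.T.F₁ g)    ≈⟨ assoc ⟨
      ((g ∘ y) ∘ M.T.F₁ f) ∘ M.T.F₁ g    ≈⟨ ∘-resp-≈ assoc Equiv.refl ⟩
      (g ∘ (y ∘ M.T.F₁ f)) ∘ M.T.F₁ g    ≈⟨ ∘-resp-≈ (∘-resp-≈ Equiv.refl h) Equiv.refl ⟨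
      (g ∘ (f ∘ x)) ∘ M.T.F₁ g           ≈⟨ ∘-resp-≈ assoc Equiv.refl ⟨
      ((g ∘ f) ∘ x) ∘ M.T.F₁ g           ≈⟨ ∘-resp-≈ (∘-resp-≈ gf Equiv.refl) Equiv.refl ⟩
      (id ∘ x) ∘ M.T.F₁ g                ≈⟨ ∘-resp-≈ identityˡ Equiv.refl ⟩
      x ∘ M.T.F₁ g                       ∎
      where
      x = EMAlgebra.action X
      y = EMAlgebra.action Y
      open HomReasoning

  EM-objectEquality : ObjectEquality (EM M) (e ⊔ q)
  EM-objectEquality = record
    { _≈ₒ_           = λ X Y → Σ[ p ∈ EMAlgebra.A X ≈ₒ EMAlgebra.A Y ]
                                 IsEMMorphism M X Y (coerce p)
    ; isEquivalenceₒ = record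
      { refl  = λ {X} → Equivₒ.refl ,
          transport {X} {X} (Equiv.sym (coerce-id Equivₒ.refl))
            (EMMorphism.commutes (EMC.id {X}))
      ; sym   = λ {X} {Y} (p , h) → Equivₒ.sym p ,
          symHom {X} {Y} (inverse p) (inverse′ p) h
      ; trans = λ {X} {Y} {Z} (p , h) (q , k) → Equivₒ.trans p q ,
          transport {X} {Z} (coerce-∘ p q (Equivₒ.trans p q))
            (EMMorphism.commutes
              (EMC._∘_ {X} {Y} {Z} (coerceHom (q , k)) (coerceHom (p , h))))
      }
    ; coerce         = coerceHom
    ; coerce-id      = λ (p , _) → coerce-id p
    ; coerce-∘       = λ (p , _) (q , _) (r , _) → coerce-∘ p q r
    }

record Frame (c ℓ₁ ℓ₂ i : Level) : Set (suc (c ⊔ ℓ₁ ⊔ ℓ₂ ⊔ i)) where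
  field
    boundedLattice : BoundedLattice c ℓ₁ ℓ₂

  open BoundedLattice boundedLattice public

  field
    ⋁         : {I : Set i} → (I → Carrier) → Carrier
    ⋁-upper   : ∀ {I : Set i} (x : I → Carrier) j → x j ≤ ⋁ x
    ⋁-least   : ∀ {I : Set i} (x : I → Carrier) y →
                (∀ j → x j ≤ y) → ⋁ x ≤ y
    ∧-distrib-⋁ : ∀ {I : Set i} x (y : I → Carrier) →
                  x ∧ ⋁ y ≈ ⋁ (λ j → x ∧ y j)

  -- n-ary meet; the empty meet ⊤ never arises on its own, arities being
  -- positive.
  ⋀ : ∀ {n} → Vector Carrier n → Carrier
  ⋀ = foldr _∧_ ⊤

  ⋀-mono : ∀ {n} {x y : Vector Carrier n} → (∀ j → x j ≤ y j) → ⋀ x ≤ ⋀ y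
  ⋀-mono {ℕ.zero}  p = refl
  ⋀-mono {ℕ.suc n} p = ∧-greatest
    (trans (x∧y≤x _ _) (p Fin.zero))
    (trans (x∧y≤y _ _) (⋀-mono (λ j → p (Fin.suc j))))

module _ {c ℓ₁ ℓ₂ i} (H : Frame c ℓ₁ ℓ₂ i) where
  private module H = Frame H

  -- The underlying set is a setoid, so that quotients are available.
  record FuzzySet (a r : Level) : Set (c ⊔ ℓ₁ ⊔ ℓ₂ ⊔ suc (a ⊔ r)) where
    field
      setoid : Setoid a r

    open Setoid setoid public

    field
      μ      : Carrier → H.Carrier
      μ-cong : ∀ {x y} → x ≈ y → μ x H.≈ μ y

  module _ {a r : Level} where

    record FuzzyMap (A B : FuzzySet a r) : Set (ℓ₂ ⊔ a ⊔ r) where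
      private
        module A = FuzzySet A
        module B = FuzzySet B
      field
        func : Func A.setoid B.setoid

      open Func func public

      field
        μ-mono : ∀ x → A.μ x H.≤ B.μ (to x)

    power : FuzzySet a r → ℕ → FuzzySet a r
    power A n = record
      { setoid = VecSetoid.≋-setoid A.setoid n
      ; μ      = λ x → H.⋀ (λ j → A.μ (x j))
      ; μ-cong = λ x≈y → H.antisym
          (H.⋀-mono (λ j → H.reflexive (A.μ-cong (x≈y j))))
          (H.⋀-mono (λ j → H.reflexive (A.μ-cong (A.sym (x≈y j)))))
      }
      where module A = FuzzySet A

    idFuz : ∀ {A} → FuzzyMap A A
    idFuz {A} = record
      { func   = Identity.function (FuzzySet.setoid A)
      ; μ-mono = λ _ → H.refl
      }

    composeFuz : ∀ {A B C} → FuzzyMap B C → FuzzyMap A B → FuzzyMap A C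
    composeFuz g f = record
      { func   = Composition.function f.func g.func
      ; μ-mono = λ x → H.trans (f.μ-mono x) (g.μ-mono (f.to x))
      }
      where
      module f = FuzzyMap f
      module g = FuzzyMap g

  Fuz : (a r : Level) →
        Category (c ⊔ ℓ₁ ⊔ ℓ₂ ⊔ suc (a ⊔ r)) (ℓ₂ ⊔ a ⊔ r) (a ⊔ r)
  Fuz a r = record
    { Obj       = FuzzySet a r
    ; _⇒_       = FuzzyMap
    ; _≈_       = λ {A} {B} f g → ∀ x →
                    FuzzySet._≈_ B (FuzzyMap.to f x) (FuzzyMap.to g x)
    ; id        = idFuz
    ; _∘_       = composeFuz
    ; assoc     = λ {_} {_} {_} {D} _ → FuzzySet.refl D
    ; identityˡ = λ {_} {B} _ → FuzzySet.refl B
    ; identityʳ = λ {_} {B} _ → FuzzySet.refl B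
    ; equiv     = λ {_} {B} → record
      { refl  = λ _ → FuzzySet.refl B
      ; sym   = λ p x → FuzzySet.sym B (p x)
      ; trans = λ p q x → FuzzySet.trans B (p x) (q x)
      }
    ; ∘-resp-≈  = λ {_} {_} {C} {f} {h} {g} {i} p q x →
        FuzzySet.trans C (FuzzyMap.cong f (q x)) (p (FuzzyMap.to i x))
    }

  -- The strictest choice: an isomorphism of categories over Fuz has to fix the
  -- underlying fuzzy sets.
  Fuz-objectEquality : (a r : Level) →
    ObjectEquality (Fuz a r) (c ⊔ ℓ₁ ⊔ ℓ₂ ⊔ suc (a ⊔ r))
  Fuz-objectEquality a r = record
    { _≈ₒ_           = _≡_
    ; isEquivalenceₒ = ≡.isEquivalence
    ; coerce         = λ { ≡.refl → idFuz }
    ; coerce-id      = λ { {A} ≡.refl x → FuzzySet.refl A }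
    ; coerce-∘       = λ { {A} ≡.refl ≡.refl ≡.refl x → FuzzySet.refl A }
    }

record Signature (o k : Level) : Set (suc (o ⊔ k)) where
  field
    Op         : Set o
    ar         : Op → ℕ
    ar-nonZero : ∀ f → NonZero (ar f)
    Const      : Set k

record Language (o k v : Level) : Set (suc (o ⊔ k ⊔ v)) where
  field
    signature : Signature o k
    Var       : Set v

  open Signature signature public

module _ {o k v} (𝓛 : Language o k v) where
  open Language 𝓛

  data Term : Set (o ⊔ k ⊔ v) where
    var   : Var → Term
    const : Const → Term
    op    : (f : Op) → Vector Term (ar f) → Term

module _ {c ℓ₁ ℓ₂ i o k v} (H : Frame c ℓ₁ ℓ₂ i) (𝓛 : Language o k v) where
  private module H = Frame H

  infix 6 _≡ᶠ_

  data Formula : Set (c ⊔ o ⊔ k ⊔ v) where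
    _≡ᶠ_ : (s t : Term 𝓛) → Formula
    𝖤    : (l : H.Carrier) (t : Term 𝓛) → Formula

  infix 5 _⊢_

  record Sequent (g : Level) : Set (c ⊔ o ⊔ k ⊔ v ⊔ suc g) where
    constructor _⊢_
    field
      premises   : Pred Formula g
      conclusion : Formula

  Theory : (g t : Level) → Set (c ⊔ o ⊔ k ⊔ v ⊔ suc (g ⊔ t))
  Theory g t = Pred (Sequent g) t

  data BasicPremise : Formula → Set (c ⊔ o ⊔ k ⊔ v) where
    equation   : ∀ x y → BasicPremise (var x ≡ᶠ var y)
    membership : ∀ l x → BasicPremise (𝖤 l (var x))

  IsBasic : ∀ {g t} → Theory g t → Set (c ⊔ o ⊔ k ⊔ v ⊔ suc g ⊔ t)
  IsBasic Λ = ∀ {Γ ψ} → (Γ ⊢ ψ) ∈ Λ → ∀ {φ} → φ ∈ Γ → BasicPremise φ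

module _ {c ℓ₁ ℓ₂ i o k} (H : Frame c ℓ₁ ℓ₂ i) (Sg : Signature o k) where
  private module H = Frame H
  open Signature Sg

  record Algebra (a r : Level) :
                 Set (c ⊔ ℓ₁ ⊔ ℓ₂ ⊔ o ⊔ k ⊔ suc (a ⊔ r)) where
    field
      carrier : FuzzySet H a r
      ⟦_⟧ᵒ    : (f : Op) → FuzzyMap H (power H carrier (ar f)) carrier
      ⟦_⟧ᶜ    : Const → FuzzySet.Carrier carrier

    module carrier = FuzzySet carrier

    apply : (f : Op) → Vector carrier.Carrier (ar f) → carrier.Carrier
    apply f = FuzzyMap.to ⟦ f ⟧ᵒ

  module _ {a r : Level} where

    record IsHomomorphism (𝓐 𝓑 : Algebra a r)
      (h : FuzzyMap H (Algebra.carrier 𝓐) (Algebra.carrier 𝓑)) :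
      Set (o ⊔ k ⊔ a ⊔ r) where
      private
        module 𝓐 = Algebra 𝓐
        module 𝓑 = Algebra 𝓑
      open FuzzyMap h using (to)
      field
        preserves-const : ∀ d → to 𝓐.⟦ d ⟧ᶜ 𝓑.carrier.≈ 𝓑.⟦ d ⟧ᶜ
        preserves-op    : ∀ f xs →
          to (𝓐.apply f xs) 𝓑.carrier.≈ 𝓑.apply f (λ j → to (xs j))

    record AlgebraMorphism (𝓐 𝓑 : Algebra a r) :
                           Set (ℓ₂ ⊔ o ⊔ k ⊔ a ⊔ r) where
      field
        arr            : FuzzyMap H (Algebra.carrier 𝓐) (Algebra.carrier 𝓑)
        isHomomorphism : IsHomomorphism 𝓐 𝓑 arr

    id-isHomomorphism : ∀ {𝓐} → IsHomomorphism 𝓐 𝓐 (idFuz H)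
    id-isHomomorphism {𝓐} = record
      { preserves-const = λ _ → Algebra.carrier.refl 𝓐
      ; preserves-op    = λ _ _ → Algebra.carrier.refl 𝓐
      }

    ∘-isHomomorphism : ∀ {𝓐 𝓑 𝓒 g f} →
      IsHomomorphism 𝓑 𝓒 g → IsHomomorphism 𝓐 𝓑 f →
      IsHomomorphism 𝓐 𝓒 (composeFuz H g f)
    ∘-isHomomorphism {𝓒 = 𝓒} {g} {f} G F = record
      { preserves-const = λ d →
          trans (FuzzyMap.cong g (F.preserves-const d)) (G.preserves-const d)
      ; preserves-op    = λ s xs →
          trans (FuzzyMap.cong g (F.preserves-op s xs))
                (G.preserves-op s (λ j → FuzzyMap.to f (xs j)))
      }
      where
      open FuzzySet (Algebra.carrier 𝓒) using (trans)
      module G = IsHomomorphism G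
      module F = IsHomomorphism F

  Alg : (a r : Level) →
        Category (c ⊔ ℓ₁ ⊔ ℓ₂ ⊔ o ⊔ k ⊔ suc (a ⊔ r)) (ℓ₂ ⊔ o ⊔ k ⊔ a ⊔ r) (a ⊔ r)
  Alg a r = record
    { Obj       = Algebra a r
    ; _⇒_       = AlgebraMorphism
    ; _≈_       = λ f g → AlgebraMorphism.arr f Fuz.≈ AlgebraMorphism.arr g
    ; id        = record
      { arr = idFuz H ; isHomomorphism = id-isHomomorphism }
    ; _∘_       = λ g f → record
      { arr            = composeFuz H (AlgebraMorphism.arr g) (AlgebraMorphism.arr f)
      ; isHomomorphism = ∘-isHomomorphism (AlgebraMorphism.isHomomorphism g)
                                          (AlgebraMorphism.isHomomorphism f)
      }
    ; assoc     = λ {_} {_} {_} {𝓓} _ → Algebra.carrier.refl 𝓓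
    ; identityˡ = λ {_} {𝓑} _ → Algebra.carrier.refl 𝓑
    ; identityʳ = λ {_} {𝓑} _ → Algebra.carrier.refl 𝓑
    ; equiv     = λ {𝓐} {𝓑} → record
      { refl  = λ _ → Algebra.carrier.refl 𝓑
      ; sym   = λ p x → Algebra.carrier.sym 𝓑 (p x)
      ; trans = λ p q x → Algebra.carrier.trans 𝓑 (p x) (q x)
      }
    ; ∘-resp-≈  = λ {_} {_} {𝓒} {f} {h} {g} {i} p q x →
        Algebra.carrier.trans 𝓒
          (FuzzyMap.cong (AlgebraMorphism.arr f) (q x))
          (p (FuzzyMap.to (AlgebraMorphism.arr i) x))
    }
    where module Fuz = Category (Fuz H a r)

  -- For p = refl, `IsHomomorphism 𝓐 𝓑 (coerce p)` says that 𝓐 and 𝓑 have the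
  -- same constants and operations on their common carrier.
  Alg-objectEquality : (a r : Level) →
    ObjectEquality (Alg a r) (c ⊔ ℓ₁ ⊔ ℓ₂ ⊔ o ⊔ k ⊔ suc (a ⊔ r))
  Alg-objectEquality a r = record
    { _≈ₒ_           = Same
    ; isEquivalenceₒ = record
      { refl  = ≡.refl , id-isHomomorphism
      ; sym   = same-sym
      ; trans = same-trans
      }
    ; coerce         = λ (p , h) → record { arr = E.coerce p ; isHomomorphism = h }
    ; coerce-id      = λ {𝓐} (p , _) → E.coerce-id p
    ; coerce-∘       = λ (p , _) (q , _) (r , _) → E.coerce-∘ p q r
    }
    where
    module E = ObjectEquality (Fuz-objectEquality H a r)

    Same : Rel (Algebra a r) _
    Same 𝓐 𝓑 = Σ[ p ∈ Algebra.carrier 𝓐 ≡ Algebra.carrier 𝓑 ]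
                 IsHomomorphism 𝓐 𝓑 (E.coerce p)

    same-sym : ∀ {𝓐 𝓑} → Same 𝓐 𝓑 → Same 𝓑 𝓐
    same-sym {record { carrier = A }} {record {}} (≡.refl , h) = ≡.refl , record
      { preserves-const = λ d → FuzzySet.sym A (preserves-const d)
      ; preserves-op    = λ f xs → FuzzySet.sym A (preserves-op f xs)
      }
      where open IsHomomorphism h

    same-trans : ∀ {𝓐 𝓑 𝓒} → Same 𝓐 𝓑 → Same 𝓑 𝓒 → Same 𝓐 𝓒
    same-trans {𝓐} {record { carrier = A }} {record {}} (p , h) (≡.refl , h′) =
      p , record
      { preserves-const = λ d →
          FuzzySet.trans A (h.preserves-const d) (h′.preserves-const d)
      ; preserves-op    = λ f xs →
          FuzzySet.trans A (h.preserves-op f xs) (h′.preserves-op f _)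
      }
      where
      module h = IsHomomorphism h
      module h′ = IsHomomorphism h′

  forget : (a r : Level) → Functor (Alg a r) (Fuz H a r)
  forget a r = record
    { F₀           = Algebra.carrier
    ; F₁           = AlgebraMorphism.arr
    ; identity     = λ {𝓐} _ → Algebra.carrier.refl 𝓐
    ; homomorphism = λ {_} {_} {𝓒} _ → Algebra.carrier.refl 𝓒
    ; F-resp-≈     = λ p → p
    }

module _ {o ℓ e p} (C : Category o ℓ e) (P : Pred (Category.Obj C) p) where
  open Category C

  FullSubcategory : Category (o ⊔ p) ℓ e
  FullSubcategory = record
    { Obj       = Σ Obj P
    ; _⇒_       = _⇒_ on proj₁
    ; _≈_       = _≈_
    ; id        = id
    ; _∘_       = _∘_
    ; assoc     = assoc
    ; identityˡ = identityˡ
    ; identityʳ = identityʳ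
    ; equiv     = equiv
    ; ∘-resp-≈  = ∘-resp-≈
    }

  inclusion : Functor FullSubcategory C
  inclusion = record
    { F₀           = proj₁
    ; F₁           = λ f → f
    ; identity     = Equiv.refl
    ; homomorphism = Equiv.refl
    ; F-resp-≈     = λ p → p
    }

  full-objectEquality : ∀ {q} → ObjectEquality C q →
                        ObjectEquality FullSubcategory q
  full-objectEquality E = record
    { _≈ₒ_           = _≈ₒ_ on proj₁
    ; isEquivalenceₒ = record
      { refl = Equivₒ.refl ; sym = Equivₒ.sym ; trans = Equivₒ.trans }
    ; coerce         = coerce
    ; coerce-id      = coerce-id
    ; coerce-∘       = coerce-∘
    }
    where open ObjectEquality E

module _ {c ℓ₁ ℓ₂ i o k v} {H : Frame c ℓ₁ ℓ₂ i} {𝓛 : Language o k v} where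
  private module H = Frame H
  open Language 𝓛

  module _ {a r} (𝓐 : Algebra H signature a r) where
    open Algebra 𝓐

    eval : (Var → carrier.Carrier) → Term 𝓛 → carrier.Carrier
    eval ι (var x)   = ι x
    eval ι (const d) = ⟦ d ⟧ᶜ
    eval ι (op f ts) = apply f (λ j → eval ι (ts j))

    Holds : (Var → carrier.Carrier) → Formula H 𝓛 → Set (ℓ₂ ⊔ r)
    Holds ι (s ≡ᶠ t) = Lift ℓ₂ (eval ι s carrier.≈ eval ι t)
    Holds ι (𝖤 l t)  = Lift r (l H.≤ carrier.μ (eval ι t))

    Satisfies : ∀ {g} → Sequent H 𝓛 g → Set (c ⊔ ℓ₂ ⊔ o ⊔ k ⊔ v ⊔ g ⊔ a ⊔ r)
    Satisfies (Γ ⊢ ψ) = ∀ ι → (∀ φ → φ ∈ Γ → Holds ι φ) → Holds ι ψ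

  module _ {g t} (Λ : Theory H 𝓛 g t) where

    IsModel : ∀ {a r} → Pred (Algebra H signature a r)
                             (c ⊔ ℓ₂ ⊔ o ⊔ k ⊔ v ⊔ suc g ⊔ t ⊔ a ⊔ r)
    IsModel 𝓐 = ∀ S → S ∈ Λ → Satisfies 𝓐 S

    Mod : (a r : Level) →
          Category (c ⊔ ℓ₁ ⊔ ℓ₂ ⊔ o ⊔ k ⊔ v ⊔ suc (g ⊔ a ⊔ r) ⊔ t)
                   (ℓ₂ ⊔ o ⊔ k ⊔ a ⊔ r) (a ⊔ r)
    Mod a r = FullSubcategory (Alg H signature a r) IsModel

    Mod-objectEquality : (a r : Level) →
      ObjectEquality (Mod a r) (c ⊔ ℓ₁ ⊔ ℓ₂ ⊔ o ⊔ k ⊔ suc (a ⊔ r))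
    Mod-objectEquality a r =
      full-objectEquality _ IsModel (Alg-objectEquality H signature a r)

    𝓤 : (a r : Level) → Functor (Mod a r) (Fuz H a r)
    𝓤 a r = forget H signature a r ∘F inclusion _ IsModel

{-# OPTIONS --safe #-}

-- An Eilenberg–Moore algebra α : T A → A makes A a Σ-algebra by
-- f(x₁,…,xₙ) = α(f(η x₁,…,η xₙ)), and associativity of α makes α itself a
-- homomorphism from the free model, split in Fuz by η.  An assignment in A
-- satisfying a set of basic premises still satisfies them after composition
-- with η, because such premises only involve variables and are preserved by
-- every fuzzy map; so the conclusion holds in the free model, and α carries it
-- back to A.  Finally α is the counit at the model A, because a homomorphism
-- out of a free model is determined by its composite with η.

module Submission where

open import Level using (Level; lift)
open import Data.Product.Base using (_×_; _,_; proj₁; proj₂)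
import Relation.Binary.PropositionalEquality.Core as ≡
import Relation.Binary.Reasoning.Setoid as SetoidReasoning
open import Defs

-- Transposition in an adjunction

module _ {o ℓ e o′ ℓ′ e′}
         {C : Category o ℓ e} {D : Category o′ ℓ′ e′}
         {L : Functor C D} {R : Functor D C} (adj : L ⊣ R) where
  private
    module C = Category C
    module D = Category D
    module L = Functor L
    module R = Functor R
  open _⊣_ adj

  -- Naturality of the counit at `f` brings `f` to the front; `zig` cancels the rest.
  untranspose-transpose : ∀ {A B} (f : L.F₀ A D.⇒ B) →
    counit.η B D.∘ L.F₁ (R.F₁ f C.∘ unit.η A) D.≈ f
  untranspose-transpose {A} {B} f = begin
    counit.η B D.∘ L.F₁ (R.F₁ f C.∘ unit.η A)          ≈⟨ D.∘-resp-≈ D.Equiv.refl L.homomorphism ⟩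
    counit.η B D.∘ (L.F₁ (R.F₁ f) D.∘ L.F₁ (unit.η A)) ≈⟨ D.assoc ⟨
    (counit.η B D.∘ L.F₁ (R.F₁ f)) D.∘ L.F₁ (unit.η A) ≈⟨ D.∘-resp-≈ (counit.commute f) D.Equiv.refl ⟩
    (f D.∘ counit.η (L.F₀ A)) D.∘ L.F₁ (unit.η A)      ≈⟨ D.assoc ⟩
    f D.∘ (counit.η (L.F₀ A) D.∘ L.F₁ (unit.η A))      ≈⟨ D.∘-resp-≈ D.Equiv.refl zig ⟩
    f D.∘ D.id                                         ≈⟨ D.identityʳ ⟩
    f                                                  ∎
    where open D.HomReasoning

  -- The uniqueness half of freeness; it identifies an action with a counit in `counit≈action`.
  transpose-injective : ∀ {A B} {f g : L.F₀ A D.⇒ B} →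
    R.F₁ f C.∘ unit.η A C.≈ R.F₁ g C.∘ unit.η A → f D.≈ g
  transpose-injective {A} {B} {f} {g} p = begin
    f                                         ≈⟨ untranspose-transpose f ⟨
    counit.η B D.∘ L.F₁ (R.F₁ f C.∘ unit.η A) ≈⟨ D.∘-resp-≈ D.Equiv.refl (L.F-resp-≈ p) ⟩
    counit.η B D.∘ L.F₁ (R.F₁ g C.∘ unit.η A) ≈⟨ untranspose-transpose g ⟩
    g                                         ∎
    where open D.HomReasoning

-- Transfer of satisfaction along maps

module _ {c ℓ₁ ℓ₂ i o k v} {H : Frame c ℓ₁ ℓ₂ i} {𝓛 : Language o k v} where
  private module H = Frame H
  open Language 𝓛

  module _ {a r} (𝓐 : Algebra H signature a r) where
    private module 𝓐 = Algebra 𝓐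

    eval-cong : ∀ {ι κ} → (∀ x → ι x 𝓐.carrier.≈ κ x) →
      ∀ t → eval {𝓛 = 𝓛} 𝓐 ι t 𝓐.carrier.≈ eval 𝓐 κ t
    eval-cong p (var x)   = p x
    eval-cong p (const d) = 𝓐.carrier.refl
    eval-cong p (op f ts) = FuzzyMap.cong 𝓐.⟦ f ⟧ᵒ (λ j → eval-cong p (ts j))

    Holds-cong : ∀ {ι κ} → (∀ x → ι x 𝓐.carrier.≈ κ x) →
      ∀ φ → Holds {𝓛 = 𝓛} 𝓐 ι φ → Holds 𝓐 κ φ
    Holds-cong p (s ≡ᶠ t) (lift q) = lift (𝓐.carrier.trans
      (𝓐.carrier.sym (eval-cong p s)) (𝓐.carrier.trans q (eval-cong p t)))
    Holds-cong p (𝖤 l t) (lift q) = lift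
      (H.trans q (H.reflexive (𝓐.carrier.μ-cong (eval-cong p t))))

  module _ {a r} {𝓐 𝓑 : Algebra H signature a r} where
    private
      module 𝓐 = Algebra 𝓐
      module 𝓑 = Algebra 𝓑

    -- Evaluating a variable never reaches an operation or a constant, so `h` may be an arbitrary
    -- fuzzy map.
    Holds-basic : (h : FuzzyMap H 𝓐.carrier 𝓑.carrier) →
      ∀ {φ} → BasicPremise H 𝓛 φ →
      ∀ {ι} → Holds 𝓐 ι φ → Holds 𝓑 (λ x → FuzzyMap.to h (ι x)) φ
    Holds-basic h (equation x y)   (lift p) = lift (FuzzyMap.cong h p)
    Holds-basic h (membership l x) (lift p) = lift (H.trans p (FuzzyMap.μ-mono h _))

    module _ (h : AlgebraMorphism H signature 𝓐 𝓑) where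
      open AlgebraMorphism h
      open FuzzyMap arr
      open IsHomomorphism isHomomorphism

      eval-homomorphism : ∀ ι t →
        to (eval {𝓛 = 𝓛} 𝓐 ι t) 𝓑.carrier.≈ eval 𝓑 (λ x → to (ι x)) t
      eval-homomorphism ι (var x)   = 𝓑.carrier.refl
      eval-homomorphism ι (const d) = preserves-const d
      eval-homomorphism ι (op f ts) = 𝓑.carrier.trans (preserves-op f _)
        (FuzzyMap.cong 𝓑.⟦ f ⟧ᵒ (λ j → eval-homomorphism ι (ts j)))

      Holds-homomorphism : ∀ {ι} (φ : Formula H 𝓛) →
        Holds 𝓐 ι φ → Holds 𝓑 (λ x → to (ι x)) φ
      Holds-homomorphism (s ≡ᶠ t) (lift p) = lift (𝓑.carrier.trans
        (𝓑.carrier.sym (eval-homomorphism _ s))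
        (𝓑.carrier.trans (cong p) (eval-homomorphism _ t)))
      Holds-homomorphism (𝖤 l t) (lift p) = lift (H.trans p (H.trans (μ-mono _)
        (H.reflexive (𝓑.carrier.μ-cong (eval-homomorphism _ t)))))

  -- The premises go up along the section `s`, which is no homomorphism in general; the conclusion,
  -- with arbitrary terms, comes down along the homomorphism `q`.
  retract-isModel : ∀ {g t a r} {Λ : Theory H 𝓛 g t} → IsBasic H 𝓛 Λ →
    {𝓐 𝓑 : Algebra H signature a r} (q : AlgebraMorphism H signature 𝓐 𝓑)
    (s : FuzzyMap H (Algebra.carrier 𝓑) (Algebra.carrier 𝓐)) →
    (∀ x → FuzzySet._≈_ (Algebra.carrier 𝓑)
             (FuzzyMap.to (AlgebraMorphism.arr q) (FuzzyMap.to s x)) x) →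
    IsModel Λ 𝓐 → IsModel Λ 𝓑
  retract-isModel basic {𝓐} {𝓑} q s qs≈id 𝓐-model (Γ ⊢ ψ) S∈Λ ι Γ-holds =
    -- The round trip yields the assignment `q ∘ s ∘ ι`, which agrees with `ι` only up to `≈`.
    Holds-cong 𝓑 (λ x → qs≈id (ι x)) ψ
      (Holds-homomorphism q ψ
        (𝓐-model (Γ ⊢ ψ) S∈Λ (λ x → FuzzyMap.to s (ι x))
          (λ φ φ∈Γ → Holds-basic {𝓐 = 𝓑} {𝓐} s (basic S∈Λ φ∈Γ) (Γ-holds φ φ∈Γ))))

-- Models from Eilenberg-Moore algebras

module _ {c ℓ₁ ℓ₂ i o k v g t a r} {H : Frame c ℓ₁ ℓ₂ i} {𝓛 : Language o k v}
         {Λ : Theory H 𝓛 g t} (basic : IsBasic H 𝓛 Λ)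
         {𝓕 : Functor (Fuz H a r) (Mod Λ a r)} (adj : 𝓕 ⊣ 𝓤 Λ a r) where
  open Language 𝓛 using (signature)

  private
    module H = Frame H
    module 𝓕 = Functor 𝓕
    module T = Monad (adjunctionMonad adj)
    open _⊣_ adj using (module unit; module counit; zag)

    module Free A = Algebra (proj₁ (𝓕.F₀ A))
    module Map {A B : FuzzySet H a r} (h : FuzzyMap H A B) =
      IsHomomorphism (AlgebraMorphism.isHomomorphism (𝓕.F₁ h))
    module Counit 𝓐 = IsHomomorphism (AlgebraMorphism.isHomomorphism (counit.η 𝓐))

    open FuzzyMap using (to)

  module EMAlgebra⇒Model (X : EMAlgebra (adjunctionMonad adj)) where
    open EMAlgebra X
    private
      module A = FuzzySet A
      module FA = Free A
      module FTA = Free (T.T.F₀ A)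
      module action = FuzzyMap action

    algebra : Algebra H signature a r
    algebra = record
      { carrier = A
      ; ⟦_⟧ᵒ    = λ f → record
        { func   = record
          { to   = λ xs → action.to (FA.apply f (λ j → to (unit.η A) (xs j)))
          ; cong = λ p → action.cong (FuzzyMap.cong FA.⟦ f ⟧ᵒ
                     (λ j → FuzzyMap.cong (unit.η A) (p j)))
          }
        ; μ-mono = λ xs → H.trans
            (H.⋀-mono (λ j → FuzzyMap.μ-mono (unit.η A) (xs j)))
            (H.trans (FuzzyMap.μ-mono FA.⟦ f ⟧ᵒ _) (action.μ-mono _))
        }
      ; ⟦_⟧ᶜ    = λ d → action.to FA.⟦ d ⟧ᶜ
      }

    -- Write each argument as μ(η t). As a counit, μ is a homomorphism and moves outside `f`;
    -- `act-assoc` trades it for `T action`, also a homomorphism, which moves back inside;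
    -- naturality of η finishes.
    action-preserves-op : ∀ f ts →
      action.to (FA.apply f ts) A.≈
      action.to (FA.apply f (λ j → to (unit.η A) (action.to (ts j))))
    action-preserves-op f ts = begin
      action.to (FA.apply f ts)
        ≈⟨ action.cong (FuzzyMap.cong FA.⟦ f ⟧ᵒ (λ j → T.μ-identityʳ (ts j))) ⟨
      action.to (FA.apply f (λ j → to (T.μ.η A) (to (unit.η (T.T.F₀ A)) (ts j))))
        ≈⟨ action.cong (Counit.preserves-op (𝓕.F₀ A) f _) ⟨
      action.to (to (T.μ.η A) (FTA.apply f (λ j → to (unit.η (T.T.F₀ A)) (ts j))))
        ≈⟨ act-assoc _ ⟨
      action.to (to (T.T.F₁ action) (FTA.apply f (λ j → to (unit.η (T.T.F₀ A)) (ts j))))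
        ≈⟨ action.cong (Map.preserves-op action f _) ⟩
      action.to (FA.apply f (λ j → to (T.T.F₁ action) (to (unit.η (T.T.F₀ A)) (ts j))))
        ≈⟨ action.cong (FuzzyMap.cong FA.⟦ f ⟧ᵒ (λ j → unit.commute action (ts j))) ⟨
      action.to (FA.apply f (λ j → to (unit.η A) (action.to (ts j)))) ∎
      where open SetoidReasoning A.setoid

    actionMorphism : AlgebraMorphism H signature (proj₁ (𝓕.F₀ A)) algebra
    actionMorphism = record
      { arr            = action
      ; isHomomorphism = record
        { preserves-const = λ _ → A.refl
        ; preserves-op    = action-preserves-op
        }
      }

    model : Category.Obj (Mod Λ a r)
    model = algebra ,
      retract-isModel basic actionMorphism (unit.η A) act-unit (proj₂ (𝓕.F₀ A))

    -- Both are homomorphisms from the free model on `A` to `model`, and both become the identity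
    -- after η: one by `zag`, the other by `act-unit`.
    counit≈action : ∀ x → to (AlgebraMorphism.arr (counit.η model)) x A.≈ action.to x
    counit≈action = transpose-injective adj {A} {model}
      {counit.η model} {actionMorphism}
      (λ x → A.trans (zag {model} x) (A.sym (act-unit x)))

  -- The inverse of the comparison functor

  open EMAlgebra⇒Model using (algebra; model; counit≈action)

  -- Compatibility with the actions replaces `h` by `T h` inside the target action. `T h` is a
  -- homomorphism of free models, and naturality of η carries `h` to the arguments.
  EMMorphism⇒Homomorphism : ∀ {X Y} (h : EMMorphism (adjunctionMonad adj) X Y) →
    IsHomomorphism H signature (algebra X) (algebra Y) (EMMorphism.arr h)
  EMMorphism⇒Homomorphism {X} {Y} h = record
    { preserves-const = λ d → B.trans (commutes _)
        (β.cong (Map.preserves-const arr d))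
    ; preserves-op    = λ f xs → B.trans (commutes _)
        (β.cong (FB.trans (Map.preserves-op arr f _)
          (FuzzyMap.cong FB.⟦ f ⟧ᵒ (λ j → FB.sym (unit.commute arr (xs j))))))
    }
    where
    open EMMorphism h
    module B = FuzzySet (EMAlgebra.A Y)
    module FB where
      open Free (EMAlgebra.A Y) public
      open carrier public using (sym; trans)
    module β = FuzzyMap (EMAlgebra.action Y)

  comparison⁻¹ : Functor (EM (adjunctionMonad adj)) (Mod Λ a r)
  comparison⁻¹ = record
    { F₀           = model
    ; F₁           = λ h → record
      { arr            = EMMorphism.arr h
      ; isHomomorphism = EMMorphism⇒Homomorphism h
      }
    ; identity     = λ {X} _ → FuzzySet.refl (EMAlgebra.A X)
    ; homomorphism = λ {_} {_} {Z} _ → FuzzySet.refl (EMAlgebra.A Z)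
    ; F-resp-≈     = λ p → p
    }

  -- The reconstructed operation is ε(f(η x₁,...,η xₙ)). Since ε is a homomorphism and ε(η x) = x by
  -- `zag`, this is the original operation.
  algebra∘comparison : ∀ 𝓐 →
    IsHomomorphism H signature (algebra (Functor.F₀ (comparison adj) 𝓐)) (proj₁ 𝓐) (idFuz H)
  algebra∘comparison 𝓐 = record
    { preserves-const = Counit.preserves-const 𝓐
    ; preserves-op    = λ f xs → 𝓐.carrier.trans (Counit.preserves-op 𝓐 f _)
        (FuzzyMap.cong 𝓐.⟦ f ⟧ᵒ (λ j → zag {𝓐} (xs j)))
    }
    where module 𝓐 = Algebra (proj₁ 𝓐)

  comparison∘model : ∀ X →
    IsEMMorphism (adjunctionMonad adj) (Functor.F₀ (comparison adj) (model X)) X (idFuz H)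
  comparison∘model X x = A.trans (counit≈action X x)
    -- The morphism condition for the identity leaves a factor `T id` before the action, to be
    -- inserted here.
    (FuzzyMap.cong action (FuzzySet.sym (T.T.F₀ A′) (T.T.identity x)))
    where
    open EMAlgebra X renaming (A to A′)
    module A = FuzzySet A′

  comparison-isIsomorphism :
    IsIsomorphism (Mod-objectEquality Λ a r)
                  (EM-objectEquality (Fuz-objectEquality H a r) (adjunctionMonad adj))
                  (comparison adj)
  comparison-isIsomorphism = record
    -- An equality of models is a carrier equality whose coercion is a homomorphism; the functor
    -- sends that coercion to a morphism of algebras, which is the compatibility required.
    { K-preserves   = record
      { cong        = λ {𝓐} {𝓑} p → proj₁ p ,
          EMMorphism.commutes (K.F₁ (E-Mod.coerce {𝓐} {𝓑} p))
      ; cong-coerce = λ {_} {𝓑} _ _ → Algebra.carrier.refl (proj₁ 𝓑)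
      }
    ; K⁻¹           = comparison⁻¹
    ; K⁻¹-preserves = record
      { cong        = λ {X} {Y} p → proj₁ p ,
          EMMorphism⇒Homomorphism {X} {Y} (E-EM.coerce {X} {Y} p)
      ; cong-coerce = λ {_} {Y} _ _ → FuzzySet.refl (EMAlgebra.A Y)
      }
    ; inverseˡ      = record
      -- Both round trips return the very same carrier, so the coercions are identities and only the
      -- structures remain to be compared.
      { eq₀ = λ X → ≡.refl , comparison∘model X
      ; eq₁ = λ {_} {Y} _ _ → FuzzySet.refl (EMAlgebra.A Y)
      }
    ; inverseʳ      = record
      { eq₀ = λ 𝓐 → ≡.refl , algebra∘comparison 𝓐
      ; eq₁ = λ {_} {𝓑} _ _ → Algebra.carrier.refl (proj₁ 𝓑)
      }
    }
    where
    module K = Functor (comparison adj)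
    module E-Mod = ObjectEquality (Mod-objectEquality Λ a r)
    module E-EM = ObjectEquality
      (EM-objectEquality (Fuz-objectEquality H a r) (adjunctionMonad adj))

theorem43 : ∀ {c ℓ₁ ℓ₂ i o k v g t a r : Level}
    (H : Frame c ℓ₁ ℓ₂ i) (𝓛 : Language o k v)
    (Λ : Theory H 𝓛 g t) → IsBasic H 𝓛 Λ →
    (𝓕 : Functor (Fuz H a r) (Mod Λ a r)) (adj : 𝓕 ⊣ 𝓤 Λ a r) →
    let T = adjunctionMonad adj
        E-Mod = Mod-objectEquality Λ a r
        E-EM = EM-objectEquality (Fuz-objectEquality H a r) T
    in IsIsomorphism E-Mod E-EM (comparison adj) × Isomorphic E-Mod E-EM
theorem43 H 𝓛 Λ basic 𝓕 adj =
  comparison-isIsomorphism basic adj , (comparison adj , comparison-isIsomorphism basic adj)
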